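{- Let $n\in\mathbb{N}\setminus\{1,2\}$ (that is, $n\ge 3$) and let $C_a:=C_{1,a_2,a_3,\dots,a_n}$ be the caterpillar tree with $n+1+\sum_{k=2}^n a_k$ vertices, where $a_k>1$ for $k\in\{2,\dots,n\}$, obtained from a path with consecutive vertices $1,2,\dots,n$ by attaching one leaf to vertex $1$ and $a_k$ leaves to vertex $k$ for each $k\in\{2,\dots,n\}$. Let $\mathcal{A}(C_a)$ and $\mathcal{A}_{RW}(C_a)$ be the evolution algebras associated to $C_a$ and to the symmetric random walk on $C_a$, respectively. Then $\mathcal{A}(C_a)\ncong\mathcal{A}_{RW}(C_a)$. Moreover, the only homomorphism between $\mathcal{A}(C_a)$ and $\mathcal{A}_{RW}(C_a)$ is the null map.
   Context: Algebras are over a field $\mathbb{K}$. Let $G=(V,E)$ be a finite simple connected graph with adjacency matrix $A=(a_{ij})_{i,j\in V}$; let $\deg(i)=\sum_{k}a_{ik}$. The evolution algebra $\mathcal{A}(G)$ associated to $G$ is the algebra with basis $\{e_i\}_{i\in V}$ and bilinear product determined by $e_i\cdot e_i=\sum_{k\in V}a_{ik}e_k$ and $e_i\cdot e_j=0$ for $i\ne j$. The evolution algebra $\mathcal{A}_{RW}(G)$ associated to the symmetric random walk on $G$ is the algebra with basis $\{e_i\}_{i\in V}$ and bilinear product determined by $e_i\cdot e_i=\sum_{k\in V}\frac{a_{ik}}{\deg(i)}e_k$ and $e_i\cdot e_j=0$ for $i\neq j$. An algebra homomorphism is a $\mathbb{K}$-linear map $f$ with $f(xy)=f(x)f(y)$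 for all $x,y$; an isomorphism (written $\cong$) is a bijective homomorphism. The null map is the map sending everything to $0$.
   Formalization: All degrees are assumed nonzero in K. The "moreover" clause (only the null map, in both directions) is proved for formally real K only; it fails e.g. over the complex numbers, where x ↦ (x_l − x_l')(e_l + i e_l') for two leaves l, l' at one vertex is a nonzero homomorphism. -}

module Defs where

open import Algebra.Apartness.Bundles using (HeytingField; HeytingCommutativeRing)
open import Algebra.Bundles using (CommutativeRing)
open import Algebra.Module.Bundles using (LeftModule)
open import Algebra.Module.Morphism.Structures using (module LeftModuleMorphisms)
import Algebra.Construct.Pointwise as Pointwise
import Algebra.Properties.Ring as RingProperties
import Algebra.Properties.Semiring.Mult as Mult
import Relation.Binary.Reasoning.Setoid as SetoidReasoning
open import Data.Bool.Base using (if_then_else_)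
open import Data.Empty using (⊥-elim)
open import Data.Fin.Base as Fin using (Fin; toℕ)
import Data.Fin.Properties as Fin
open import Data.List.Base using (List; []; _∷_; _++_; map; concatMap; allFin; foldr; sum)
open import Data.List.Membership.Propositional using (_∈_; lose)
open import Data.List.Membership.Propositional.Properties
  using (∈-map⁺; ∈-map⁻; ∈-++⁺ˡ; ∈-++⁺ʳ; ∈-concatMap⁺; ∈-concatMap⁻; ∈-allFin)
open import Data.List.Relation.Unary.All as All using (All; []; _∷_)
import Data.List.Relation.Unary.All.Properties as All
open import Data.List.Relation.Unary.AllPairs as AllPairs using (_∷_)
import Data.List.Relation.Unary.AllPairs.Properties as AllPairs
open import Data.List.Relation.Unary.Any as Any using (here; there)
open import Data.List.Relation.Unary.Unique.Propositional using (Unique)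
import Data.List.Relation.Unary.Unique.Propositional.Properties as Unique
open import Data.Nat.Base as ℕ using (ℕ; zero; suc; s≤s)
import Data.Nat.Properties as ℕ
open import Data.Product.Base using (Σ; _×_; _,_; proj₁; proj₂)
open import Data.Sum.Base using (_⊎_; inj₁; inj₂)
open import Function.Base using (_∘_)
open import Function.Definitions using (Bijective)
open import Level using (Level; _⊔_; 0ℓ) renaming (suc to lsuc)
open import Relation.Binary.Construct.Closure.ReflexiveTransitive using (Star; ε; _◅_; _◅◅_)
import Relation.Binary.Construct.Closure.ReflexiveTransitive as Star
open import Relation.Binary.Core using (Rel)
open import Relation.Binary.Definitions using (Decidable; DecidableEquality; Symmetric)
open import Relation.Binary.PropositionalEquality as ≡ using (_≡_; _≢_; refl; cong)
open import Relation.Nullary.Decidable using (yes; no; does; _⊎-dec_; map′)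
open import Relation.Nullary.Negation using (¬_)

private
  variable
    c ℓ₁ ℓ₂ r ℓr a ℓa b ℓb : Level

record FiniteConnectedGraph : Set₁ where
  infix 4 _~_ _~?_ _≟_
  field
    Vertex     : Set
    _≟_        : DecidableEquality Vertex
    vertices   : List Vertex
    unique     : Unique vertices
    complete   : ∀ v → v ∈ vertices
    _~_        : Rel Vertex 0ℓ
    _~?_       : Decidable _~_
    ~-sym      : Symmetric _~_
    ~-irrefl   : ∀ v → ¬ (v ~ v)
    connected  : ∀ u v → Star _~_ u v

  adjacency : Vertex → Vertex → ℕ
  adjacency i k = if does (i ~? k) then 1 else 0

  deg : Vertex → ℕ
  deg i = sum (map (adjacency i) vertices)

module _ {n : ℕ} (leaves : Fin n → ℕ) where

  data CatVertex : Set where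
    spine : Fin n → CatVertex
    leaf  : (k : Fin n) → Fin (leaves k) → CatVertex

  Consecutive : Fin n → Fin n → Set
  Consecutive i j = suc (toℕ i) ≡ toℕ j ⊎ suc (toℕ j) ≡ toℕ i

  data CatEdge : Rel CatVertex 0ℓ where
    path  : ∀ {i j} → Consecutive i j → CatEdge (spine i) (spine j)
    down  : ∀ {k l} → CatEdge (spine k) (leaf k l)
    up    : ∀ {k l} → CatEdge (leaf k l) (spine k)

module _ {n : ℕ} {leaves : Fin n → ℕ} where

  private
    V : Set
    V = CatVertex leaves

  spine-injective : ∀ {i j} → _≡_ {A = V} (spine i) (spine j) → i ≡ j
  spine-injective refl = refl

  leaf-injective : ∀ {k i j} → _≡_ {A = V} (leaf k i) (leaf k j) → i ≡ j
  leaf-injective refl = refl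

  catVertex-≟ : DecidableEquality V
  catVertex-≟ (spine i)  (spine j)  = map′ (cong spine) spine-injective (i Fin.≟ j)
  catVertex-≟ (spine _)  (leaf _ _) = no λ ()
  catVertex-≟ (leaf _ _) (spine _)  = no λ ()
  catVertex-≟ (leaf k i) (leaf m j) with k Fin.≟ m
  ... | yes refl = map′ (cong (leaf k)) leaf-injective (i Fin.≟ j)
  ... | no k≢m   = no λ { refl → k≢m refl }

  catEdge? : Decidable (CatEdge leaves)
  catEdge? (spine i) (spine j) =
    map′ path (λ { (path p) → p })
      ((suc (toℕ i) ℕ.≟ toℕ j) ⊎-dec (suc (toℕ j) ℕ.≟ toℕ i))
  catEdge? (spine i) (leaf k _) with i Fin.≟ k
  ... | yes refl = yes down
  ... | no i≢k   = no λ { down → i≢k refl }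
  catEdge? (leaf k _) (spine i) with k Fin.≟ i
  ... | yes refl = yes up
  ... | no k≢i   = no λ { up → k≢i refl }
  catEdge? (leaf _ _) (leaf _ _) = no λ ()

  catEdge-sym : Symmetric (CatEdge leaves)
  catEdge-sym (path (inj₁ p)) = path (inj₂ p)
  catEdge-sym (path (inj₂ p)) = path (inj₁ p)
  catEdge-sym down            = up
  catEdge-sym up              = down

  catEdge-irrefl : ∀ v → ¬ CatEdge leaves v v
  catEdge-irrefl (spine i) (path (inj₁ p)) = ℕ.1+n≢n p
  catEdge-irrefl (spine i) (path (inj₂ p)) = ℕ.1+n≢n p

  leavesAt : Fin n → List V
  leavesAt k = map (leaf k) (allFin (leaves k))

  catVertices : List V
  catVertices = map spine (allFin n) ++ concatMap leavesAt (allFin n)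

  catVertices-complete : ∀ v → v ∈ catVertices
  catVertices-complete (spine i)  = ∈-++⁺ˡ (∈-map⁺ spine (∈-allFin i))
  catVertices-complete (leaf k l) = ∈-++⁺ʳ (map spine (allFin n))
    (∈-concatMap⁺ leavesAt (lose (∈-allFin k) (∈-map⁺ (leaf k) (∈-allFin l))))

  private
    spine∉leaves : ∀ {i} xs → ¬ (spine i ∈ concatMap leavesAt xs)
    spine∉leaves xs p with Any.satisfied (∈-concatMap⁻ leavesAt {xs = xs} p)
    ... | k , q with ∈-map⁻ (leaf k) q
    ...   | _ , _ , ()

    leavesAt-disjoint : ∀ {k m v} → k ≢ m → ¬ (v ∈ leavesAt k × v ∈ leavesAt m)
    leavesAt-disjoint {k} {m} k≢m (p , q) with ∈-map⁻ (leaf k) p | ∈-map⁻ (leaf m) q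
    ... | _ , _ , refl | _ , _ , refl = k≢m refl

  catVertices-unique : Unique catVertices
  catVertices-unique = Unique.++⁺
    (Unique.map⁺ spine-injective (Unique.allFin⁺ n))
    (Unique.concat⁺
      (All.map⁺ (All.universal (λ k → Unique.map⁺ leaf-injective (Unique.allFin⁺ (leaves k))) (allFin n)))
      (AllPairs.map⁺ (AllPairs.map (λ k≢m {_} → leavesAt-disjoint k≢m) (Unique.allFin⁺ n))))
    λ { (p , q) → case-spine p q }
    where
    case-spine : ∀ {v} → v ∈ map spine (allFin n) → ¬ (v ∈ concatMap leavesAt (allFin n))
    case-spine p q with ∈-map⁻ spine p
    ... | _ , _ , refl = spine∉leaves (allFin n) q

  private
    Path : Rel V 0ℓ
    Path = Star (CatEdge leaves)

    ascend : ∀ d (i j : Fin n) → d ℕ.+ toℕ i ≡ toℕ j → Path (spine i) (spine j)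
    ascend zero i j eq with Fin.toℕ-injective eq
    ... | refl = ε
    ascend (suc d) i j eq =
      path (inj₁ (≡.sym (Fin.toℕ-fromℕ< i′<n))) ◅ ascend d (Fin.fromℕ< i′<n) j
        (≡.trans (cong (d ℕ.+_) (Fin.toℕ-fromℕ< i′<n))
          (≡.trans (ℕ.+-suc d (toℕ i)) eq))
      where
      i′<n : suc (toℕ i) ℕ.< n
      i′<n = ℕ.≤-<-trans
        (ℕ.≤-trans (s≤s (ℕ.m≤n+m (toℕ i) d)) (ℕ.≤-reflexive eq)) (Fin.toℕ<n j)

    spine-connected : ∀ i j → Path (spine i) (spine j)
    spine-connected i j with ℕ.≤-total (toℕ i) (toℕ j)
    ... | inj₁ i≤j = ascend _ i j (ℕ.m∸n+n≡m i≤j)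
    ... | inj₂ j≤i = Star.reverse catEdge-sym (ascend _ j i (ℕ.m∸n+n≡m j≤i))

    toSpine : ∀ v → Σ (Fin n) λ i → Path v (spine i)
    toSpine (spine i)  = i , ε
    toSpine (leaf k _) = k , up ◅ ε

  cat-connected : ∀ u v → Star (CatEdge leaves) u v
  cat-connected u v = proj₂ (toSpine u) ◅◅ spine-connected _ _
    ◅◅ Star.reverse catEdge-sym (proj₂ (toSpine v))

caterpillar : ∀ {n} → (Fin n → ℕ) → FiniteConnectedGraph
caterpillar leaves = record
  { Vertex    = CatVertex leaves
  ; _≟_       = catVertex-≟
  ; vertices  = catVertices
  ; unique    = catVertices-unique
  ; complete  = catVertices-complete
  ; _~_       = CatEdge leaves
  ; _~?_      = catEdge?
  ; ~-sym     = catEdge-sym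
  ; ~-irrefl  = catEdge-irrefl
  ; connected = cat-connected
  }

record NonAssociativeAlgebra (R : CommutativeRing r ℓr) a ℓa
       : Set (r ⊔ ℓr ⊔ lsuc (a ⊔ ℓa)) where
  open CommutativeRing R using (ring; Carrier)
  infixl 7 _∙_
  field
    leftModule : LeftModule ring a ℓa
  open LeftModule leftModule public
  field
    _∙_        : Carrierᴹ → Carrierᴹ → Carrierᴹ
    ∙-cong     : ∀ {x x′ y y′} → x ≈ᴹ x′ → y ≈ᴹ y′ → x ∙ y ≈ᴹ x′ ∙ y′
    ∙-distribˡ : ∀ x y z → x ∙ (y +ᴹ z) ≈ᴹ x ∙ y +ᴹ x ∙ z
    ∙-distribʳ : ∀ x y z → (y +ᴹ z) ∙ x ≈ᴹ y ∙ x +ᴹ z ∙ x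
    ∙-*ₗˡ      : ∀ (k : Carrier) x y → (k *ₗ x) ∙ y ≈ᴹ k *ₗ (x ∙ y)
    ∙-*ₗʳ      : ∀ (k : Carrier) x y → x ∙ (k *ₗ y) ≈ᴹ k *ₗ (x ∙ y)

module _ {R : CommutativeRing r ℓr}
         (A : NonAssociativeAlgebra R a ℓa) (B : NonAssociativeAlgebra R b ℓb) where

  private
    module A = NonAssociativeAlgebra A
    module B = NonAssociativeAlgebra B
  open LeftModuleMorphisms A.rawLeftModule B.rawLeftModule using (IsLeftModuleHomomorphism)

  record IsAlgebraHomomorphism (f : A.Carrierᴹ → B.Carrierᴹ) : Set (r ⊔ a ⊔ ℓa ⊔ ℓb) where
    field
      isLeftModuleHomomorphism : IsLeftModuleHomomorphism f
      ∙-homo                   : ∀ x y → f (x A.∙ y) B.≈ᴹ f x B.∙ f y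
    open IsLeftModuleHomomorphism isLeftModuleHomomorphism public

  record IsAlgebraIsomorphism (f : A.Carrierᴹ → B.Carrierᴹ) : Set (r ⊔ a ⊔ ℓa ⊔ b ⊔ ℓb) where
    field
      isAlgebraHomomorphism : IsAlgebraHomomorphism f
      bijective             : Bijective A._≈ᴹ_ B._≈ᴹ_ f
    open IsAlgebraHomomorphism isAlgebraHomomorphism public

  infix 4 _≅_
  _≅_ : Set (r ⊔ a ⊔ ℓa ⊔ b ⊔ ℓb)
  _≅_ = Σ (A.Carrierᴹ → B.Carrierᴹ) IsAlgebraIsomorphism

  IsNullMap : (A.Carrierᴹ → B.Carrierᴹ) → Set (a ⊔ ℓb)
  IsNullMap f = ∀ x → f x B.≈ᴹ B.0ᴹ

-- A field is a Heyting field; classically (taking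
-- x # y to be ¬ (x ≈ y)) these are exactly the fields.

module Evolution (K : HeytingField c ℓ₁ ℓ₂) where

  open HeytingField K renaming (refl to ≈-refl; sym to ≈-sym; trans to ≈-trans)
    hiding (zero)

  R : CommutativeRing c ℓ₁
  R = HeytingCommutativeRing.commutativeRing heytingCommutativeRing

  open CommutativeRing R using (ring; semiring)
  open Mult semiring using () renaming (_×_ to _×ₙ_)
  open RingProperties ring using (-0#≈0#)
  open SetoidReasoning setoid

  fromℕ : ℕ → Carrier
  fromℕ n = n ×ₙ 1#

  recip : ∀ {x} → x # 0# → Carrier
  recip x#0 = proj₁ (#⇒invertible x#0)

  -- `#⇒invertible` inverts the difference x - 0#, which is x up to ≈.
  recip-inverseʳ : ∀ {x} (x#0 : x # 0#) → x * recip x#0 ≈ 1#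
  recip-inverseʳ {x} x#0 = begin
    x * recip x#0         ≈⟨ *-congʳ (≈-trans (+-congˡ -0#≈0#) (+-identityʳ x)) ⟨
    (x - 0#) * recip x#0  ≈⟨ proj₂ (proj₂ (#⇒invertible x#0)) ⟩
    1#                    ∎

  ∑ : ∀ {i} {I : Set i} → List I → (I → Carrier) → Carrier
  ∑ is f = foldr (λ i s → f i + s) 0# is

  ∑-cong : ∀ {i} {I : Set i} (is : List I) {f g : I → Carrier} →
           (∀ i → f i ≈ g i) → ∑ is f ≈ ∑ is g
  ∑-cong []       eq = ≈-refl
  ∑-cong (i ∷ is) eq = +-cong (eq i) (∑-cong is eq)

  ∑-+ : ∀ {i} {I : Set i} (is : List I) (f g : I → Carrier) →
        ∑ is (λ i → f i + g i) ≈ ∑ is f + ∑ is g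
  ∑-+ []       f g = ≈-sym (+-identityʳ 0#)
  ∑-+ (i ∷ is) f g = begin
    (f i + g i) + ∑ is (λ i → f i + g i)  ≈⟨ +-congˡ (∑-+ is f g) ⟩
    (f i + g i) + (∑ is f + ∑ is g)       ≈⟨ +-assoc _ _ _ ⟩
    f i + (g i + (∑ is f + ∑ is g))       ≈⟨ +-congˡ (+-assoc _ _ _) ⟨
    f i + ((g i + ∑ is f) + ∑ is g)       ≈⟨ +-congˡ (+-congʳ (+-comm _ _)) ⟩
    f i + ((∑ is f + g i) + ∑ is g)       ≈⟨ +-congˡ (+-assoc _ _ _) ⟩
    f i + (∑ is f + (g i + ∑ is g))       ≈⟨ +-assoc _ _ _ ⟨
    (f i + ∑ is f) + (g i + ∑ is g)       ∎

  ∑-* : ∀ {i} {I : Set i} (is : List I) k (f : I → Carrier) →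
        ∑ is (λ i → k * f i) ≈ k * ∑ is f
  ∑-* []       k f = ≈-sym (zeroʳ k)
  ∑-* (i ∷ is) k f = ≈-trans (+-congˡ (∑-* is k f)) (≈-sym (distribˡ k _ _))

  ∑-zero : ∀ {i} {I : Set i} {is : List I} {f : I → Carrier} →
           All (λ i → f i ≈ 0#) is → ∑ is f ≈ 0#
  ∑-zero []       = ≈-refl
  ∑-zero (p ∷ ps) = ≈-trans (+-cong p (∑-zero ps)) (+-identityʳ 0#)

  -- Needed for the uniqueness of the null homomorphism.  If ι * ι = -1 and
  -- l, l′ are leaves at a common vertex, then v = e l + ι e l′ satisfies
  -- v ∙ v = 0, and x ↦ (x l - x l′) v is a nonzero homomorphism, because
  -- x ↦ x l - x l′ vanishes on all products.
  FormallyReal : Set (c ⊔ ℓ₁)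
  FormallyReal = ∀ (xs : List Carrier) → ∑ xs (λ x → x * x) ≈ 0# → All (_≈ 0#) xs

  module _ (G : FiniteConnectedGraph) where

    open FiniteConnectedGraph G

    coordinateModule : LeftModule ring c ℓ₁
    coordinateModule = record
      { Carrierᴹ = Vertex → Carrier
      ; _≈ᴹ_     = λ x y → ∀ i → x i ≈ y i
      ; _+ᴹ_     = λ x y i → x i + y i
      ; _*ₗ_     = λ k x i → k * x i
      ; 0ᴹ       = λ _ → 0#
      ; -ᴹ_      = λ x i → - x i
      ; isLeftModule = record
        { isLeftSemimodule = record
          { +ᴹ-isCommutativeMonoid = Pointwise.isCommutativeMonoid Vertex +-isCommutativeMonoid
          ; isPreleftSemimodule    = record
            { *ₗ-cong      = λ p q i → *-cong p (q i)
            ; *ₗ-zeroˡ     = λ x i → zeroˡ (x i)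
            ; *ₗ-distribʳ  = λ x k l i → distribʳ (x i) k l
            ; *ₗ-identityˡ = λ x i → *-identityˡ (x i)
            ; *ₗ-assoc     = λ k l x i → *-assoc k l (x i)
            ; *ₗ-zeroʳ     = λ k i → zeroʳ k
            ; *ₗ-distribˡ  = λ k x y i → distribˡ k (x i) (y i)
            }
          }
        ; -ᴹ‿cong    = λ p i → -‿cong (p i)
        ; -ᴹ‿inverse = (λ x i → -‿inverseˡ (x i)) , (λ x i → -‿inverseʳ (x i))
        }
      }

    -- x = Σᵢ xᵢ eᵢ is represented by its coordinates, so by bilinearity
    -- x ∙ y = Σᵢ xᵢ yᵢ (eᵢ ∙ eᵢ), where eᵢ ∙ eᵢ = Σₖ cᵢₖ eₖ.
    evolutionAlgebra : (Vertex → Vertex → Carrier) → NonAssociativeAlgebra R c ℓ₁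
    evolutionAlgebra C = record
      { leftModule = coordinateModule
      ; _∙_        = λ x y k → ∑ vertices λ i → (x i * y i) * C i k
      ; ∙-cong     = λ p q k → ∑-cong vertices λ i → *-congʳ (*-cong (p i) (q i))
      ; ∙-distribˡ = λ x y z k → ≈-trans
          (∑-cong vertices λ i → ≈-trans (*-congʳ (distribˡ (x i) (y i) (z i))) (distribʳ _ _ _))
          (∑-+ vertices _ _)
      ; ∙-distribʳ = λ x y z k → ≈-trans
          (∑-cong vertices λ i → ≈-trans (*-congʳ (distribʳ (x i) (y i) (z i))) (distribʳ _ _ _))
          (∑-+ vertices _ _)
      ; ∙-*ₗˡ      = λ l x y k → ≈-trans
          (∑-cong vertices λ i → ≈-trans (*-congʳ (*-assoc l (x i) (y i))) (*-assoc l _ _))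
          (∑-* vertices l _)
      ; ∙-*ₗʳ      = λ l x y k → ≈-trans
          (∑-cong vertices λ i → ≈-trans
            (*-congʳ (≈-trans (≈-sym (*-assoc (x i) l (y i)))
              (≈-trans (*-congʳ (*-comm (x i) l)) (*-assoc l (x i) (y i)))))
            (*-assoc l _ _))
          (∑-* vertices l _)
      }

    e : Vertex → Vertex → Carrier
    e i k = if does (i ≟ k) then 1# else 0#

    e-same : ∀ i → e i i ≈ 1#
    e-same i with i ≟ i
    ... | yes _  = ≈-refl
    ... | no i≢i = ⊥-elim (i≢i refl)

    e-diff : ∀ {i k} → i ≢ k → e i k ≈ 0#
    e-diff {i} {k} i≢k with i ≟ k
    ... | yes i≡k = ⊥-elim (i≢k i≡k)
    ... | no _    = ≈-refl

    ∑-delta : ∀ {is i} → Unique is → i ∈ is → (f : Vertex → Carrier) →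
              (∀ {k} → i ≢ k → f k ≈ 0#) → ∑ is f ≈ f i
    ∑-delta (i∉is ∷ _) (here refl) f f≈0 =
      ≈-trans (+-congˡ (∑-zero (All.map f≈0 i∉is))) (+-identityʳ _)
    ∑-delta (j∉is ∷ u) (there i∈is) f f≈0 =
      ≈-trans (+-cong (f≈0 λ i≡j → All.lookup j∉is i∈is (≡.sym i≡j)) (∑-delta u i∈is f f≈0))
        (+-identityˡ _)

    module _ (C : Vertex → Vertex → Carrier) where
      open NonAssociativeAlgebra (evolutionAlgebra C)

      e∙e-same : ∀ i → e i ∙ e i ≈ᴹ C i
      e∙e-same i k = ≈-trans
        (∑-delta unique (complete i) _ λ i≢j →
          ≈-trans (*-congʳ (≈-trans (*-congʳ (e-diff i≢j)) (zeroˡ _))) (zeroˡ _))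
        (≈-trans (*-congʳ (≈-trans (*-cong (e-same i) (e-same i)) (*-identityˡ 1#)))
          (*-identityˡ _))

      e∙e-diff : ∀ {i j} → i ≢ j → e i ∙ e j ≈ᴹ 0ᴹ
      e∙e-diff {i} {j} i≢j k = ∑-zero (All.universal vanish vertices)
        where
        vanish : ∀ v → (e i v * e j v) * C v k ≈ 0#
        vanish v with i ≟ v
        ... | no _     = ≈-trans (*-congʳ (zeroˡ _)) (zeroˡ _)
        ... | yes refl = ≈-trans (*-congʳ (≈-trans (*-congˡ (e-diff (i≢j ∘ ≡.sym))) (zeroʳ _))) (zeroˡ _)

    𝒜 : NonAssociativeAlgebra R c ℓ₁
    𝒜 = evolutionAlgebra λ i k → fromℕ (adjacency i k)

    -- The quotients aᵢₖ / deg(i) only make sense when every degree is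
    -- nonzero in the field, e.g. in characteristic 0.
    DegreesNonzero : Set ℓ₂
    DegreesNonzero = ∀ i → fromℕ (deg i) # 0#

    𝒜RW : DegreesNonzero → NonAssociativeAlgebra R c ℓ₁
    𝒜RW deg#0 = evolutionAlgebra λ i k → fromℕ (adjacency i k) * recip (deg#0 i)

{-# OPTIONS --safe #-}

-- Write e(p) for the basis and v(p) = f (e(p)).  Both algebras have the form
-- e(p)² = w(p) · (sum of the neighbours of p) with invertible weights w.  If p ≠ q,
-- then v(p) v(q) = 0, so at every spine vertex at most one v(p) has a nonzero
-- coordinate.  Two leaves l, l′ at k satisfy v(l)² = v(k) = v(l′)² and
-- v(l) v(l′) = 0, hence have no spine coordinates; so v(k) lives on the
-- spine for every spine vertex k other than the first, S₀.  The single leaf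
-- at S₀ leaves no room for two orthogonal vectors, so only v(S₀) can have a
-- nonzero S₀-coordinate.  If it has one, the relations at the first three
-- spine vertices force the weights of the two algebras to agree at S₀ and
-- S₁, i.e. deg S₀ = 1 in the field, whereas deg S₀ = 2.  So no image has an
-- S₀-coordinate and f is not surjective.  Over a formally real field the
-- vanishing then propagates along the spine, and from the spine to the leaves.
module Submission where

open import Defs
open import Algebra.Apartness.Bundles using (HeytingField)
open import Algebra.Bundles using (CommutativeRing)
import Algebra.Apartness.Properties.HeytingCommutativeRing as HeytingProperties
import Algebra.Properties.Group as GroupProperties
import Algebra.Properties.Ring as RingProperties
import Algebra.Properties.Semiring.Mult as Mult
import Algebra.Solver.Ring.NaturalCoefficients.Default as SemiringSolver
import Relation.Binary.Reasoning.Setoid as SetoidReasoning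
open import Data.Empty using (⊥-elim)
open import Data.Fin.Base using (Fin; zero; suc; toℕ; fromℕ<; inject₁)
import Data.Fin.Properties as Fin
open import Data.List.Base as List using (List; []; map)
open import Data.List.Membership.Propositional.Properties using (∈-map⁺)
import Data.List.Relation.Unary.All as All
open import Data.Nat.Base using (ℕ; zero; suc; _≤_; _<_; z≤n; s≤s)
import Data.Nat.Properties as ℕ
open import Data.Nat.ListAction using (sum)
open import Data.Product.Base using (∃; _×_; _,_; proj₁; proj₂)
open import Data.Sum.Base using (inj₁; inj₂)
open import Data.Vec.Functional using (Vector; _∷_)
open import Function.Bundles using (_⇔_; mk⇔)
open import Level using (_⊔_)
open import Relation.Binary.PropositionalEquality as ≡ using (_≡_; _≢_; refl)
open import Relation.Nullary.Decidable using (yes; no)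
open import Relation.Nullary.Negation using (¬_)

-- Units, zero tests and sums in a Heyting field

module HeytingFieldLemmas {c ℓ₁ ℓ₂} (K : HeytingField c ℓ₁ ℓ₂) where

  open Evolution K
  open HeytingField K renaming (refl to ≈-refl; sym to ≈-sym; trans to ≈-trans) hiding (zero)
  open CommutativeRing R using (semiring; commutativeSemiring)
  open Mult semiring using (×-homo-+)
  open SemiringSolver commutativeSemiring using (solve; _:*_; _:=_)
  open SetoidReasoning setoid

  Unit : Carrier → Set (c ⊔ ℓ₁)
  Unit x = ∃ λ y → x * y ≈ 1#

  1≉0 : ¬ (1# ≈ 0#)
  1≉0 1≈0 = proj₂ (tight 1# 0#) 1≈0 (HeytingProperties.1#0 heytingCommutativeRing)

  -- Stands in for the case split "zero or invertible", as equality need not be decidable: by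
  -- tightness it suffices to refute `x # 0#`, and an element apart from zero is a unit.
  zero-unless-unit : ∀ {x} → (Unit x → x ≈ 0#) → x ≈ 0#
  zero-unless-unit {x} h = proj₁ (tight x 0#) λ x#0 →
    proj₂ (tight x 0#) (h (recip x#0 , recip-inverseʳ x#0)) x#0

  unit-resp-≈ : ∀ {x y} → x ≈ y → Unit x → Unit y
  unit-resp-≈ x≈y (x⁻¹ , eq) = x⁻¹ , ≈-trans (*-congʳ (≈-sym x≈y)) eq

  unit-* : ∀ {x y} → Unit x → Unit y → Unit (x * y)
  unit-* {x} {y} (x⁻¹ , p) (y⁻¹ , q) = x⁻¹ * y⁻¹ , (begin
    (x * y) * (x⁻¹ * y⁻¹)  ≈⟨ solve 4 (λ x y z w → (x :* y) :* (z :* w) := (x :* z) :* (y :* w)) ≈-refl x y x⁻¹ y⁻¹ ⟩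
    (x * x⁻¹) * (y * y⁻¹)  ≈⟨ *-cong p q ⟩
    1# * 1#                ≈⟨ *-identityˡ 1# ⟩
    1#                     ∎)

  unit-factorˡ : ∀ {x y} → Unit (x * y) → Unit x
  unit-factorˡ {x} {y} (z , p) = y * z , ≈-trans (≈-sym (*-assoc x y z)) p

  unit-cancelˡ : ∀ {x y z} → Unit x → x * y ≈ x * z → y ≈ z
  unit-cancelˡ {x} {y} {z} (x⁻¹ , p) eq = begin
    y              ≈⟨ lemma y ⟩
    x⁻¹ * (x * y)  ≈⟨ *-congˡ eq ⟩
    x⁻¹ * (x * z)  ≈⟨ lemma z ⟨
    z              ∎
    where
    lemma : ∀ t → t ≈ x⁻¹ * (x * t)
    lemma t = begin
      t              ≈⟨ *-identityˡ t ⟨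
      1# * t         ≈⟨ *-congʳ p ⟨
      (x * x⁻¹) * t  ≈⟨ *-congʳ (*-comm x x⁻¹) ⟩
      (x⁻¹ * x) * t  ≈⟨ *-assoc x⁻¹ x t ⟩
      x⁻¹ * (x * t)  ∎

  unit-cancelʳ : ∀ {x y z} → Unit x → y * x ≈ z * x → y ≈ z
  unit-cancelʳ {x} {y} {z} u eq =
    unit-cancelˡ u (≈-trans (*-comm x y) (≈-trans eq (*-comm z x)))

  unit-zeroˡ : ∀ {x y} → Unit x → x * y ≈ 0# → y ≈ 0#
  unit-zeroˡ {x} u eq = unit-cancelˡ u (≈-trans eq (≈-sym (zeroʳ x)))

  unit-zeroʳ : ∀ {x y} → Unit x → y * x ≈ 0# → y ≈ 0#
  unit-zeroʳ {x} u eq = unit-cancelʳ u (≈-trans eq (≈-sym (zeroˡ x)))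

  *-zeroˡ : ∀ {x y} → x ≈ 0# → x * y ≈ 0#
  *-zeroˡ x≈0 = ≈-trans (*-congʳ x≈0) (zeroˡ _)

  *-zeroʳ : ∀ {x y} → y ≈ 0# → x * y ≈ 0#
  *-zeroʳ y≈0 = ≈-trans (*-congˡ y≈0) (zeroʳ _)

  square≈0 : ∀ {x} → x * x ≈ 0# → x ≈ 0#
  square≈0 x²≈0 = zero-unless-unit λ u → unit-zeroˡ u x²≈0

  -- x⁴ = x²y² = (xy)² = 0. It is applied to coordinates of the images of two leaves at a common
  -- spine vertex.
  equal-squares≈0 : ∀ {x y} → x * x ≈ y * y → x * y ≈ 0# → x ≈ 0#
  equal-squares≈0 {x} {y} x²≈y² xy≈0 = square≈0 (square≈0 (begin
    (x * x) * (x * x)  ≈⟨ *-congˡ x²≈y² ⟩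
    (x * x) * (y * y)  ≈⟨ solve 2 (λ x y → (x :* x) :* (y :* y) := (x :* y) :* (x :* y)) ≈-refl x y ⟩
    (x * y) * (x * y)  ≈⟨ *-zeroˡ xy≈0 ⟩
    0#                 ∎))

  fromℕ-sum : ∀ {i} {I : Set i} (is : List I) (g : I → ℕ) →
              fromℕ (sum (map g is)) ≈ ∑ is (λ i → fromℕ (g i))
  fromℕ-sum []       g = ≈-refl
  fromℕ-sum (i List.∷ is) g = ≈-trans (×-homo-+ 1# (g i) (sum (map g is))) (+-congˡ (fromℕ-sum is g))

  -- Evolution algebras with weighted adjacency

  module _ (G : FiniteConnectedGraph) where

    open FiniteConnectedGraph G using (Vertex; vertices; unique; complete; adjacency; deg; _~_; _~?_; ~-sym)

    adjacency-edge : ∀ {i k} → i ~ k → fromℕ (adjacency i k) ≈ 1#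
    adjacency-edge {i} {k} i~k with i ~? k
    ... | yes _ = +-identityʳ 1#
    ... | no i≁k = ⊥-elim (i≁k i~k)

    adjacency-nonedge : ∀ {i k} → ¬ (i ~ k) → fromℕ (adjacency i k) ≈ 0#
    adjacency-nonedge {i} {k} i≁k with i ~? k
    ... | yes i~k = ⊥-elim (i≁k i~k)
    ... | no _  = ≈-refl

    deg-∑ : ∀ i → fromℕ (deg i) ≈ ∑ vertices (λ k → fromℕ (adjacency i k))
    deg-∑ i = fromℕ-sum vertices (adjacency i)

    ∑-at : ∀ p {g : Vertex → Carrier} → (∀ q → p ≢ q → g q ≈ 0#) → ∑ vertices g ≈ g p
    ∑-at p h = ∑-delta G unique (complete p) _ λ {q} → h q

    ∑-e : ∀ p → ∑ vertices (e G p) ≈ 1#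
    ∑-e p = ≈-trans (∑-at p λ q → e-diff G) (e-same G p)

    -- Covers both algebras at once: `α` is constantly 1 for `𝒜` and 1/deg for `𝒜RW`.
    record Weighted (C : Vertex → Vertex → Carrier) (α : Vertex → Carrier) : Set (c ⊔ ℓ₁) where
      field
        edge    : ∀ {i k} → i ~ k → C i k ≈ α i
        nonedge : ∀ {i k} → ¬ (i ~ k) → C i k ≈ 0#
        unit    : ∀ i → Unit (α i)

      -- With `g q = x q * y q` the sum is the coordinate of a product at `k`. Only neighbours of
      -- `k` contribute, so one term survives once the others are known to vanish.
      inflow-at : ∀ {g : Vertex → Carrier} {p k} → p ~ k →
                  (∀ q → q ~ k → p ≢ q → g q ≈ 0#) →
                  ∑ vertices (λ q → g q * C q k) ≈ g p * α p
      inflow-at {g} {p} {k} p~k h = ≈-trans (∑-at p others) (*-congˡ (edge p~k))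
        where
        others : ∀ q → p ≢ q → g q * C q k ≈ 0#
        others q p≢q with q ~? k
        ... | yes q~k = *-zeroˡ (h q q~k p≢q)
        ... | no q≁k  = *-zeroʳ (nonedge q≁k)

      -- With `g q = f (e G q) k` the sum is, by `image-square`, a coordinate of the image of e(i)².
      -- Only neighbours of `i` contribute.
      outflow-at : ∀ {g : Vertex → Carrier} {i p} → p ~ i →
                   (∀ q → q ~ i → p ≢ q → g q ≈ 0#) →
                   ∑ vertices (λ q → C i q * g q) ≈ α i * g p
      outflow-at {g} {i} {p} p~i h = ≈-trans (∑-at p others) (*-congʳ (edge (~-sym p~i)))
        where
        others : ∀ q → p ≢ q → C i q * g q ≈ 0#
        others q p≢q with i ~? q
        ... | yes i~q = *-zeroʳ (h q (~-sym i~q) p≢q)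
        ... | no i≁q  = *-zeroˡ (nonedge i≁q)

      outflow-zero : ∀ {g : Vertex → Carrier} {i} → (∀ q → q ~ i → g q ≈ 0#) →
                     ∑ vertices (λ q → C i q * g q) ≈ 0#
      outflow-zero {g} {i} h = ∑-zero (All.universal each vertices)
        where
        each : ∀ q → C i q * g q ≈ 0#
        each q with i ~? q
        ... | yes i~q = *-zeroʳ (h q (~-sym i~q))
        ... | no i≁q  = *-zeroˡ (nonedge i≁q)

    module _ {C D : Vertex → Vertex → Carrier} {f : (Vertex → Carrier) → Vertex → Carrier}
             (hom : IsAlgebraHomomorphism (evolutionAlgebra G C) (evolutionAlgebra G D) f) where

      open IsAlgebraHomomorphism hom using (+ᴹ-homo; *ₗ-homo; 0ᴹ-homo; ⟦⟧-cong; ∙-homo)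

      image-expansion : ∀ x k → f x k ≈ ∑ vertices (λ i → x i * f (e G i) k)
      image-expansion x k = ≈-trans
        (⟦⟧-cong (λ q → ≈-sym (≈-trans
          (∑-at q λ i q≢i → *-zeroʳ (e-diff G λ i≡q → q≢i (≡.sym i≡q)))
          (≈-trans (*-congˡ (e-same G q)) (*-identityʳ _)))) k)
        (image-∑ vertices)
        where
        image-∑ : ∀ is → f (λ q → ∑ is (λ i → x i * e G i q)) k ≈ ∑ is (λ i → x i * f (e G i) k)
        image-∑ []       = 0ᴹ-homo k
        image-∑ (i List.∷ is) = ≈-trans (+ᴹ-homo _ _ k) (+-cong (*ₗ-homo _ _ k) (image-∑ is))

      image-orthogonal : ∀ {i j} → i ≢ j → ∀ k →
                         ∑ vertices (λ q → (f (e G i) q * f (e G j) q) * D q k) ≈ 0#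
      image-orthogonal {i} {j} i≢j k = ≈-trans (≈-sym (∙-homo (e G i) (e G j) k))
        (≈-trans (⟦⟧-cong (e∙e-diff G C i≢j) k) (0ᴹ-homo k))

      image-square : ∀ i k → ∑ vertices (λ q → (f (e G i) q * f (e G i) q) * D q k)
                           ≈ ∑ vertices (λ j → C i j * f (e G j) k)
      image-square i k = ≈-trans (≈-sym (∙-homo (e G i) (e G i) k))
        (≈-trans (⟦⟧-cong (e∙e-same G C i) k) (image-expansion (C i) k))

private
  another : ∀ {n} → 1 < n → (l : Fin n) → ∃ λ l′ → l ≢ l′
  another (s≤s (s≤s _)) zero    = suc zero , λ ()
  another (s≤s (s≤s _)) (suc l) = zero , λ ()

-- The caterpillar: neighbourhoods and degrees

module CaterpillarHomomorphism
  {c ℓ₁ ℓ₂} (K : HeytingField c ℓ₁ ℓ₂) (m : ℕ)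
  (a : Vector ℕ (suc (suc m))) (1<a : ∀ (k : Fin (suc (suc m))) → 1 < a k) where

  open Evolution K
  open HeytingFieldLemmas K
  open HeytingField K renaming (refl to ≈-refl; sym to ≈-sym; trans to ≈-trans) hiding (zero)
  open CommutativeRing R using (ring)
  open RingProperties ring using (+-cancelʳ)
  open SetoidReasoning setoid

  Cₐ : FiniteConnectedGraph
  Cₐ = caterpillar (1 ∷ a)

  V : Set
  V = CatVertex (1 ∷ a)

  open FiniteConnectedGraph Cₐ using (vertices; complete; adjacency; deg; _~_)

  -- Vertex k of the paper is the spine vertex with index k - 1.
  S₀ S₁ S₂ L₀ : V
  S₀ = spine zero
  S₁ = spine (suc zero)
  S₂ = spine (suc (suc zero))
  L₀ = leaf zero zero

  some-leaf : ∀ k → Fin ((1 ∷ a) k)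
  some-leaf zero    = zero
  some-leaf (suc k) = fromℕ< {0} (ℕ.<-trans (s≤s z≤n) (1<a k))

  near-leaf : ∀ {ℓ} {P : V → Set ℓ} {k l} → P (spine k) → ∀ q → q ~ leaf k l → P q
  near-leaf p (spine _) down = p

  near-S₀ : ∀ {ℓ} {P : V → Set ℓ} → P L₀ → P S₁ → ∀ q → q ~ S₀ → P q
  near-S₀ p₀ p₁ (leaf zero zero)        up              = p₀
  near-S₀ p₀ p₁ (spine zero)            (path (inj₁ ()))
  near-S₀ p₀ p₁ (spine zero)            (path (inj₂ ()))
  near-S₀ p₀ p₁ (spine (suc zero))      _               = p₁
  near-S₀ p₀ p₁ (spine (suc (suc _)))   (path (inj₁ ()))
  near-S₀ p₀ p₁ (spine (suc (suc _)))   (path (inj₂ ()))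

  near-S₁ : ∀ {ℓ} {P : V → Set ℓ} → (∀ l → P (leaf (suc zero) l)) → P S₀ → P S₂ →
            ∀ q → q ~ S₁ → P q
  near-S₁ pₗ p₀ p₂ (leaf _ l)                    up               = pₗ l
  near-S₁ pₗ p₀ p₂ (spine zero)                  _                = p₀
  near-S₁ pₗ p₀ p₂ (spine (suc zero))            (path (inj₁ ()))
  near-S₁ pₗ p₀ p₂ (spine (suc zero))            (path (inj₂ ()))
  near-S₁ pₗ p₀ p₂ (spine (suc (suc zero)))      _                = p₂
  near-S₁ pₗ p₀ p₂ (spine (suc (suc (suc _))))   (path (inj₁ ()))
  near-S₁ pₗ p₀ p₂ (spine (suc (suc (suc _))))   (path (inj₂ ()))

  S₀~S₁ : S₀ ~ S₁
  S₀~S₁ = path (inj₁ refl)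

  S₁~S₀ : S₁ ~ S₀
  S₁~S₀ = path (inj₂ refl)

  S₁~S₂ : S₁ ~ S₂
  S₁~S₂ = path (inj₁ refl)

  S₂~S₁ : S₂ ~ S₁
  S₂~S₁ = path (inj₂ refl)

  -- Closes the case of the excluded neighbour when a `near-` lemma supplies the premise of
  -- `inflow-at` or `outflow-at`.
  itself : ∀ {p : V} {x} → p ≢ p → x ≈ 0#
  itself p≢p = ⊥-elim (p≢p refl)

  -- The sum of the basis vectors of the leaves at `S₁`: the leaf part of e(S₁)², up to its weight.
  s : V → Carrier
  s (leaf (suc zero) _) = 1#
  s _                   = 0#

  -- The image of a₂ in K, of which only σ + 2 = deg S₁ is needed.
  σ : Carrier
  σ = ∑ vertices s

  -- The list of vertices depends on `a`, so the degree does not evaluate; instead the adjacency row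
  -- is split into basis vectors, each of coordinate sum 1.
  deg-S₀ : fromℕ (deg S₀) ≈ 1# + 1#
  deg-S₀ = begin
    fromℕ (deg S₀)                                     ≈⟨ deg-∑ Cₐ S₀ ⟩
    ∑ vertices (λ q → fromℕ (adjacency S₀ q))          ≈⟨ ∑-cong vertices row ⟩
    ∑ vertices (λ q → e Cₐ L₀ q + e Cₐ S₁ q)           ≈⟨ ∑-+ vertices _ _ ⟩
    ∑ vertices (e Cₐ L₀) + ∑ vertices (e Cₐ S₁)        ≈⟨ +-cong (∑-e Cₐ L₀) (∑-e Cₐ S₁) ⟩
    1# + 1#                                            ∎
    where
    row : ∀ q → fromℕ (adjacency S₀ q) ≈ e Cₐ L₀ q + e Cₐ S₁ q
    row (leaf zero zero)      = ≈-refl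
    row (leaf (suc _) _)      = ≈-sym (+-identityʳ 0#)
    row (spine zero)          = ≈-sym (+-identityʳ 0#)
    row (spine (suc zero))    = +-comm 1# 0#
    row (spine (suc (suc _))) = ≈-sym (+-identityʳ 0#)

  deg-S₁ : fromℕ (deg S₁) ≈ σ + (1# + 1#)
  deg-S₁ = begin
    fromℕ (deg S₁)                                         ≈⟨ deg-∑ Cₐ S₁ ⟩
    ∑ vertices (λ q → fromℕ (adjacency S₁ q))              ≈⟨ ∑-cong vertices row ⟩
    ∑ vertices (λ q → s q + (e Cₐ S₀ q + e Cₐ S₂ q))       ≈⟨ ∑-+ vertices _ _ ⟩
    σ + ∑ vertices (λ q → e Cₐ S₀ q + e Cₐ S₂ q)           ≈⟨ +-congˡ (∑-+ vertices _ _) ⟩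
    σ + (∑ vertices (e Cₐ S₀) + ∑ vertices (e Cₐ S₂))      ≈⟨ +-congˡ (+-cong (∑-e Cₐ S₀) (∑-e Cₐ S₂)) ⟩
    σ + (1# + 1#)                                          ∎
    where
    0≈0+0+0 : 0# ≈ 0# + (0# + 0#)
    0≈0+0+0 = ≈-sym (≈-trans (+-identityˡ _) (+-identityˡ _))
    row : ∀ q → fromℕ (adjacency S₁ q) ≈ s q + (e Cₐ S₀ q + e Cₐ S₂ q)
    row (leaf zero _)               = 0≈0+0+0
    row (leaf (suc zero) _)         = +-congˡ (≈-sym (+-identityʳ 0#))
    row (leaf (suc (suc _)) _)      = 0≈0+0+0
    row (spine zero)                = ≈-sym (+-identityˡ _)
    row (spine (suc zero))          = 0≈0+0+0
    row (spine (suc (suc zero)))    = ≈-trans (+-comm _ _) (+-congˡ (≈-sym (+-identityˡ _)))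
    row (spine (suc (suc (suc _)))) = 0≈0+0+0

  deg-leaf : ∀ {k l} → fromℕ (deg (leaf k l)) ≈ 1#
  deg-leaf {k} {l} = ≈-trans (deg-∑ Cₐ (leaf k l))
    (≈-trans (∑-at Cₐ (spine k) others) (adjacency-edge Cₐ {i = leaf k l} up))
    where
    others : ∀ q → spine k ≢ q → fromℕ (adjacency (leaf k l) q) ≈ 0#
    others q k≢q = adjacency-nonedge Cₐ {i = leaf k l} {q} λ { up → k≢q refl }

  -- Coordinates of the images of basis vectors

  module Images
    {C D : V → V → Carrier} {α β : V → Carrier}
    (C-weighted : Weighted Cₐ C α) (D-weighted : Weighted Cₐ D β)
    (α-leaf : ∀ {k l} → α (leaf k l) ≈ 1#) (β-leaf : ∀ {k l} → β (leaf k l) ≈ 1#)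
    -- One weight is 1 and the other is 1/deg, so equal weights at a vertex mean degree 1 in the
    -- field.
    (deg-ratio : ∀ k → α (spine k) ≈ β (spine k) → fromℕ (deg (spine k)) ≈ 1#)
    {f : (V → Carrier) → V → Carrier}
    (hom : IsAlgebraHomomorphism (evolutionAlgebra Cₐ C) (evolutionAlgebra Cₐ D) f) where

    private
      module C = Weighted C-weighted
      module D = Weighted D-weighted

    v : V → V → Carrier
    v i = f (e Cₐ i)

    square : V → V → Carrier
    square i k = ∑ vertices λ q → (v i q * v i q) * D q k

    v-square : ∀ i k → square i k ≈ ∑ vertices (λ j → C i j * v j k)
    v-square = image-square Cₐ hom

    -- The only neighbour of a leaf is its spine vertex, so reading a square at a leaf isolates one
    -- spine coordinate.
    square-leaf : ∀ i k {l} → square i (leaf k l) ≈ (v i (spine k) * v i (spine k)) * β (spine k)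
    square-leaf i k {l} = D.inflow-at {k = leaf k l} down (near-leaf itself)

    leaf-square : ∀ k l x → square (leaf k l) x ≈ v (spine k) x
    leaf-square k l x = ≈-trans (v-square (leaf k l) x)
      (≈-trans (C.outflow-at {i = leaf k l} down (near-leaf itself))
        (≈-trans (*-congʳ α-leaf) (*-identityˡ _)))

    -- Reading v(i) v(j) = 0 at a leaf of `spine k` leaves a single product times a unit.
    spine-orthogonal : ∀ {i j} → i ≢ j → ∀ k → v i (spine k) * v j (spine k) ≈ 0#
    spine-orthogonal i≢j k = unit-zeroʳ (D.unit (spine k)) (≈-trans
      (≈-sym (D.inflow-at {k = leaf k (some-leaf k)} down (near-leaf itself)))
      (image-orthogonal Cₐ hom i≢j (leaf k (some-leaf k))))

    vanishes-beside : ∀ {i j} → i ≢ j → ∀ {k} → Unit (v i (spine k)) → v j (spine k) ≈ 0#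
    vanishes-beside i≢j {k} u = unit-zeroˡ u (spine-orthogonal i≢j k)

    spine-on-leaf : ∀ k l j {l′} →
      v (spine k) (leaf j l′) ≈ (v (leaf k l) (spine j) * v (leaf k l) (spine j)) * β (spine j)
    spine-on-leaf k l j {l′} =
      ≈-trans (≈-sym (leaf-square k l (leaf j l′))) (square-leaf (leaf k l) j)

    private
      twins-≢ : ∀ {k l l′} → l ≢ l′ → _≢_ {A = V} (leaf (suc k) l) (leaf (suc k) l′)
      twins-≢ l≢l′ eq = l≢l′ (leaf-injective eq)

    -- The index `suc k` excludes `S₀`, so `leaf (suc k) l` has a twin. Both twins square to the
    -- image of their spine vertex, and `spine-on-leaf` reads the two squares at a leaf of
    -- `spine j`.
    leaf-on-spine : ∀ k l j → v (leaf (suc k) l) (spine j) ≈ 0#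
    leaf-on-spine k l j with another (1<a k) l
    ... | l′ , l≢l′ = equal-squares≈0
      (unit-cancelʳ (D.unit (spine j))
        (≈-trans (≈-sym (spine-on-leaf (suc k) l j {some-leaf j})) (spine-on-leaf (suc k) l′ j)))
      (spine-orthogonal (twins-≢ l≢l′) j)

    spine-on-leaf≈0 : ∀ k j l → v (spine (suc k)) (leaf j l) ≈ 0#
    spine-on-leaf≈0 k j l = ≈-trans (spine-on-leaf (suc k) (some-leaf (suc k)) j)
      (*-zeroˡ (*-zeroˡ (leaf-on-spine k (some-leaf (suc k)) j)))

    -- The twin argument again, read at `S₀`: its neighbours are `L₀` and `S₁`, and `leaf-on-spine`
    -- removes the `S₁` term.
    leaf-on-L₀ : ∀ k l → v (leaf (suc k) l) L₀ ≈ 0#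
    leaf-on-L₀ k l with another (1<a k) l
    ... | l′ , l≢l′ = equal-squares≈0
      (≈-trans (square-L₀ l) (≈-sym (square-L₀ l′)))
      (unit-zeroʳ (D.unit L₀) (≈-trans
        (≈-sym (D.inflow-at {p = L₀} up (near-S₀ itself λ _ → *-zeroˡ (leaf-on-spine k l (suc zero)))))
        (image-orthogonal Cₐ hom (twins-≢ l≢l′) S₀)))
      where
      square-L₀ : ∀ l → v (leaf (suc k) l) L₀ * v (leaf (suc k) l) L₀ ≈ v (spine (suc k)) S₀
      square-L₀ l = begin
        v (leaf (suc k) l) L₀ * v (leaf (suc k) l) L₀         ≈⟨ *-identityʳ _ ⟨
        v (leaf (suc k) l) L₀ * v (leaf (suc k) l) L₀ * 1#    ≈⟨ *-congˡ β-leaf ⟨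
        v (leaf (suc k) l) L₀ * v (leaf (suc k) l) L₀ * β L₀  ≈⟨ D.inflow-at {p = L₀} up (near-S₀ itself λ _ → *-zeroˡ (leaf-on-spine k l (suc zero))) ⟨
        square (leaf (suc k) l) S₀                            ≈⟨ leaf-square (suc k) l S₀ ⟩
        v (spine (suc k)) S₀                                  ∎

    spine-on-S₀ : ∀ k → v (spine (suc k)) S₀ ≈ 0#
    spine-on-S₀ k = begin
      v (spine (suc k)) S₀  ≈⟨ leaf-square (suc k) l S₀ ⟨
      square (leaf (suc k) l) S₀  ≈⟨ D.inflow-at {p = L₀} up (near-S₀ itself λ _ → *-zeroˡ (leaf-on-spine k l (suc zero))) ⟩
      v (leaf (suc k) l) L₀ * v (leaf (suc k) l) L₀ * β L₀  ≈⟨ *-zeroˡ (*-zeroˡ (leaf-on-L₀ k l)) ⟩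
      0#                    ∎
      where
      l : Fin (a k)
      l = some-leaf (suc k)

    -- `L₀` has no twin, so the detour is through e(S₁)². Read at `leaf k l`, its image vanishes
    -- because v(S₁) has no coordinate at `spine k`; the leaf and `S₂` terms vanish too, which
    -- leaves the coordinate of v(S₀). That coordinate is the square of the one sought, up to a
    -- unit, since L₀ squares to S₀.
    L₀-on-spine≈0 : ∀ k l → v S₁ (spine k) ≈ 0# → (∀ l′ → v (leaf (suc zero) l′) (leaf k l) ≈ 0#) →
                    v L₀ (spine k) ≈ 0#
    L₀-on-spine≈0 k l S₁≈0 leaves≈0 = square≈0 (unit-zeroʳ (D.unit (spine k)) (begin
      v L₀ (spine k) * v L₀ (spine k) * β (spine k)  ≈⟨ spine-on-leaf zero zero k ⟨
      v S₀ (leaf k l)                                ≈⟨ unit-zeroˡ (C.unit S₁) α*≈0 ⟩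
      0#                                             ∎))
      where
      α*≈0 : α S₁ * v S₀ (leaf k l) ≈ 0#
      α*≈0 = begin
        α S₁ * v S₀ (leaf k l)                       ≈⟨ C.outflow-at {i = S₁} S₀~S₁ (near-S₁ (λ l′ _ → leaves≈0 l′) itself λ _ → spine-on-leaf≈0 (suc zero) k l) ⟨
        ∑ vertices (λ j → C S₁ j * v j (leaf k l))   ≈⟨ v-square S₁ (leaf k l) ⟨
        square S₁ (leaf k l)                         ≈⟨ square-leaf S₁ k ⟩
        v S₁ (spine k) * v S₁ (spine k) * β (spine k) ≈⟨ *-zeroˡ (*-zeroˡ S₁≈0) ⟩
        0#                                           ∎

    L₀-on-S₀ : v L₀ S₀ ≈ 0#
    L₀-on-S₀ = L₀-on-spine≈0 zero zero (spine-on-S₀ zero) (leaf-on-L₀ zero)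

    -- Excluding a nonzero `S₀`-coordinate of v(S₀)

    -- The hypothesis on S₀ is contradictory: it forces equal weights at S₀
    -- and S₁, hence deg S₁ = 1, so that σ = -1 is invertible; then x = v S₁ S₁
    -- satisfies x = x⁴, and deg S₀ = 1 as well.
    module S₀-supports-S₀ (S₀-unit : Unit (v S₀ S₀)) where

      x : Carrier
      x = v S₁ S₁

      -- Among the neighbours of `S₁`, only `S₀` has an image that can be nonzero at `S₀`. The right
      -- side is a unit by hypothesis, which makes `x` a unit.
      S₁-square-S₀ : (x * x) * β S₁ ≈ α S₁ * v S₀ S₀
      S₁-square-S₀ = begin
        (x * x) * β S₁                       ≈⟨ D.inflow-at {p = S₁} {k = S₀} S₁~S₀ (near-S₀ (λ _ → *-zeroˡ (spine-on-leaf≈0 zero zero zero)) itself) ⟨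
        square S₁ S₀                         ≈⟨ v-square S₁ S₀ ⟩
        ∑ vertices (λ j → C S₁ j * v j S₀)   ≈⟨ C.outflow-at {i = S₁} S₀~S₁ (near-S₁ (λ l _ → leaf-on-spine zero l zero) itself λ _ → spine-on-S₀ (suc zero)) ⟩
        α S₁ * v S₀ S₀                       ∎

      x-unit : Unit x
      x-unit = unit-factorˡ (unit-factorˡ
        (unit-resp-≈ (≈-sym S₁-square-S₀) (unit-* (C.unit S₁) S₀-unit)))

      -- Since `x` is a unit, orthogonality removes the `S₁`-coordinates of all other images. The
      -- relation makes `v S₂ S₂` a unit, which in turn clears `S₂` from v(S₀).
      S₂-square-S₁ : (v S₂ S₂ * v S₂ S₂) * β S₂ ≈ α S₂ * x
      S₂-square-S₁ = begin
        (v S₂ S₂ * v S₂ S₂) * β S₂           ≈⟨ D.inflow-at {p = S₂} {k = S₁} S₂~S₁ (near-S₁ (λ l _ → *-zeroˡ (spine-on-leaf≈0 (suc zero) (suc zero) l)) (λ _ → *-zeroˡ (spine-on-S₀ (suc zero))) itself) ⟨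
        square S₂ S₁                         ≈⟨ v-square S₂ S₁ ⟩
        ∑ vertices (λ j → C S₂ j * v j S₁)   ≈⟨ C.outflow-at {i = S₂} S₁~S₂ (λ q _ S₁≢q → vanishes-beside S₁≢q x-unit) ⟩
        α S₂ * x                             ∎

      S₂-unit : Unit (v S₂ S₂)
      S₂-unit = unit-factorˡ (unit-factorˡ
        (unit-resp-≈ (≈-sym S₂-square-S₁) (unit-* (C.unit S₂) x-unit)))

      L₀-on-S₁ : v L₀ S₁ ≈ 0#
      L₀-on-S₁ = vanishes-beside {S₁} {L₀} (λ ()) x-unit

      S₀-on-S₂ : v S₀ S₂ ≈ 0#
      S₀-on-S₂ = vanishes-beside {S₂} {S₀} (λ ()) S₂-unit

      S₀-on-leaf : ∀ l → v S₀ (leaf (suc zero) l) ≈ 0#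
      S₀-on-leaf l = ≈-trans (spine-on-leaf zero zero (suc zero)) (*-zeroˡ (*-zeroˡ L₀-on-S₁))

      L₀-square-S₀ : v L₀ L₀ * v L₀ L₀ ≈ v S₀ S₀
      L₀-square-S₀ = begin
        v L₀ L₀ * v L₀ L₀          ≈⟨ *-identityʳ _ ⟨
        v L₀ L₀ * v L₀ L₀ * 1#     ≈⟨ *-congˡ β-leaf ⟨
        v L₀ L₀ * v L₀ L₀ * β L₀   ≈⟨ D.inflow-at {p = L₀} {k = S₀} up (near-S₀ itself λ _ → *-zeroˡ L₀-on-S₁) ⟨
        square L₀ S₀               ≈⟨ leaf-square zero zero S₀ ⟩
        v S₀ S₀                    ∎

      S₀-square-L₀ : (v S₀ S₀ * v S₀ S₀) * β S₀ ≈ α S₀ * v L₀ L₀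
      S₀-square-L₀ = begin
        (v S₀ S₀ * v S₀ S₀) * β S₀           ≈⟨ square-leaf S₀ zero {zero} ⟨
        square S₀ L₀                         ≈⟨ v-square S₀ L₀ ⟩
        ∑ vertices (λ j → C S₀ j * v j L₀)   ≈⟨ C.outflow-at {i = S₀} up (near-S₀ itself λ _ → spine-on-leaf≈0 zero zero zero) ⟩
        α S₀ * v L₀ L₀                       ∎

      S₀-square-S₁ : (v S₀ S₀ * v S₀ S₀) * β S₀ ≈ α S₀ * x
      S₀-square-S₁ = begin
        (v S₀ S₀ * v S₀ S₀) * β S₀           ≈⟨ D.inflow-at {p = S₀} {k = S₁} S₀~S₁ (near-S₁ (λ l _ → *-zeroˡ (S₀-on-leaf l)) itself λ _ → *-zeroˡ S₀-on-S₂) ⟨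
        square S₀ S₁                         ≈⟨ v-square S₀ S₁ ⟩
        ∑ vertices (λ j → C S₀ j * v j S₁)   ≈⟨ C.outflow-at {i = S₀} S₁~S₀ (near-S₀ (λ _ → L₀-on-S₁) itself) ⟩
        α S₀ * x                             ∎

      -- The image of e(S₀)² has equal coordinates at `L₀` and `S₁`, because v(S₀) enters both only
      -- through its `S₀`-coordinate. Comparing them gives `v L₀ L₀ ≈ x`, and L₀ squares to S₀.
      S₀-coordinate : v S₀ S₀ ≈ x * x
      S₀-coordinate = ≈-trans (≈-sym L₀-square-S₀) (*-cong L₀≈x L₀≈x)
        where
        L₀≈x : v L₀ L₀ ≈ x
        L₀≈x = unit-cancelˡ (C.unit S₀) (≈-trans (≈-sym S₀-square-L₀) S₀-square-S₁)

      weights-S₁ : α S₁ ≈ β S₁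
      weights-S₁ = unit-cancelʳ (unit-* x-unit x-unit) (begin
        α S₁ * (x * x)  ≈⟨ *-congˡ S₀-coordinate ⟨
        α S₁ * v S₀ S₀  ≈⟨ S₁-square-S₀ ⟨
        (x * x) * β S₁  ≈⟨ *-comm _ _ ⟩
        β S₁ * (x * x)  ∎)

      image-s-spine : ∀ k → f s (spine k) ≈ 0#
      image-s-spine k = ≈-trans (image-expansion Cₐ hom s (spine k)) (∑-zero (All.universal each vertices))
        where
        each : ∀ i → s i * v i (spine k) ≈ 0#
        each (leaf zero _)          = zeroˡ _
        each (leaf (suc zero) l)    = *-zeroʳ (leaf-on-spine zero l k)
        each (leaf (suc (suc _)) _) = zeroˡ _
        each (spine _)              = zeroˡ _

      -- In e(S₁)² the images of the spine neighbours vanish at the leaves of `S₁`, so only the `s`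
      -- part is seen there.
      image-s-leaf : ∀ l → f s (leaf (suc zero) l) ≈ x * x
      image-s-leaf l = unit-cancelˡ (C.unit S₁) (≈-sym (begin
        α S₁ * (x * x)                              ≈⟨ *-congʳ weights-S₁ ⟩
        β S₁ * (x * x)                              ≈⟨ *-comm _ _ ⟩
        (x * x) * β S₁                              ≈⟨ square-leaf S₁ (suc zero) ⟨
        square S₁ t                                 ≈⟨ v-square S₁ t ⟩
        ∑ vertices (λ i → C S₁ i * v i t)           ≈⟨ ∑-cong vertices each ⟩
        ∑ vertices (λ i → α S₁ * (s i * v i t))     ≈⟨ ∑-* vertices (α S₁) _ ⟩
        α S₁ * ∑ vertices (λ i → s i * v i t)       ≈⟨ *-congˡ (image-expansion Cₐ hom s t) ⟨
        α S₁ * f s t                                ∎))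
        where
        t : V
        t = leaf (suc zero) l
        each : ∀ i → C S₁ i * v i t ≈ α S₁ * (s i * v i t)
        each (leaf zero _)          = ≈-trans (*-zeroˡ (C.nonedge λ ())) (≈-sym (*-zeroʳ (zeroˡ _)))
        each (leaf (suc zero) _)    = *-cong (C.edge down) (≈-sym (*-identityˡ _))
        each (leaf (suc (suc _)) _) = ≈-trans (*-zeroˡ (C.nonedge λ ())) (≈-sym (*-zeroʳ (zeroˡ _)))
        each (spine zero)           = ≈-trans (*-zeroʳ (S₀-on-leaf l)) (≈-sym (*-zeroʳ (zeroˡ _)))
        each (spine (suc k))        = ≈-trans (*-zeroʳ (spine-on-leaf≈0 k (suc zero) l)) (≈-sym (*-zeroʳ (zeroˡ _)))

      -- Both sides are the S₁-coordinate of f (s ∙ s), since s ∙ s = σ e(S₁).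
      norm-of-image-s : σ * x ≈ σ * ((x * x) * (x * x))
      norm-of-image-s = begin
        σ * x                                              ≈⟨ *-congʳ ss-S₁ ⟨
        ss S₁ * x                                          ≈⟨ ∑-at Cₐ S₁ (λ i S₁≢i → *-zeroˡ (ss-other i S₁≢i)) ⟨
        ∑ vertices (λ i → ss i * v i S₁)                   ≈⟨ image-expansion Cₐ hom ss S₁ ⟨
        f ss S₁                                            ≈⟨ IsAlgebraHomomorphism.∙-homo hom s s S₁ ⟩
        ∑ vertices (λ q → (f s q * f s q) * D q S₁)        ≈⟨ ∑-cong vertices each ⟩
        ∑ vertices (λ q → ((x * x) * (x * x)) * s q)       ≈⟨ ∑-* vertices _ s ⟩
        ((x * x) * (x * x)) * σ                            ≈⟨ *-comm _ _ ⟩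
        σ * ((x * x) * (x * x))                            ∎
        where
        ss : V → Carrier
        ss k = ∑ vertices λ q → (s q * s q) * C q k

        ss-S₁ : ss S₁ ≈ σ
        ss-S₁ = ∑-cong vertices term
          where
          term : ∀ q → (s q * s q) * C q S₁ ≈ s q
          term (leaf zero _)          = *-zeroˡ (zeroˡ _)
          term (leaf (suc zero) _)    =
            ≈-trans (*-cong (*-identityˡ _) (≈-trans (C.edge up) α-leaf)) (*-identityˡ _)
          term (leaf (suc (suc _)) _) = *-zeroˡ (zeroˡ _)
          term (spine _)              = *-zeroˡ (zeroˡ _)

        ss-other : ∀ i → S₁ ≢ i → ss i ≈ 0#
        ss-other i S₁≢i = ∑-zero (All.universal term vertices)
          where
          term : ∀ q → (s q * s q) * C q i ≈ 0#
          term (leaf zero _)          = *-zeroˡ (zeroˡ _)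
          term (leaf (suc zero) _)    = *-zeroʳ (C.nonedge λ { up → S₁≢i refl })
          term (leaf (suc (suc _)) _) = *-zeroˡ (zeroˡ _)
          term (spine _)              = *-zeroˡ (zeroˡ _)

        each : ∀ q → (f s q * f s q) * D q S₁ ≈ ((x * x) * (x * x)) * s q
        each (leaf zero _)          = ≈-trans (*-zeroʳ (D.nonedge λ ())) (≈-sym (zeroʳ _))
        each (leaf (suc zero) l)    =
          *-cong (*-cong (image-s-leaf l) (image-s-leaf l)) (≈-trans (D.edge up) β-leaf)
        each (leaf (suc (suc _)) _) = ≈-trans (*-zeroʳ (D.nonedge λ ())) (≈-sym (zeroʳ _))
        each (spine k)              = ≈-trans (*-zeroˡ (*-zeroˡ (image-s-spine k))) (≈-sym (zeroʳ _))

      1+σ≈0 : 1# + σ ≈ 0#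
      1+σ≈0 = +-cancelʳ 1# (1# + σ) 0# (begin
        (1# + σ) + 1#   ≈⟨ +-congʳ (+-comm 1# σ) ⟩
        (σ + 1#) + 1#   ≈⟨ +-assoc σ 1# 1# ⟩
        σ + (1# + 1#)   ≈⟨ deg-S₁ ⟨
        fromℕ (deg S₁)  ≈⟨ deg-ratio (suc zero) weights-S₁ ⟩
        1#              ≈⟨ +-identityˡ 1# ⟨
        0# + 1#         ∎)

      -- Multiplication by σ is negation; `x≈x⁴` uses this to cancel σ from `norm-of-image-s`.
      1+σ-kills : ∀ y → y + σ * y ≈ 0#
      1+σ-kills y = begin
        y + σ * y        ≈⟨ +-congʳ (*-identityˡ y) ⟨
        1# * y + σ * y   ≈⟨ distribʳ y 1# σ ⟨
        (1# + σ) * y     ≈⟨ *-zeroˡ 1+σ≈0 ⟩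
        0#               ∎

      x≈x⁴ : x ≈ (x * x) * (x * x)
      x≈x⁴ = +-cancelʳ (σ * x) _ _ (begin
        x + σ * x                                     ≈⟨ 1+σ-kills x ⟩
        0#                                            ≈⟨ 1+σ-kills ((x * x) * (x * x)) ⟨
        (x * x) * (x * x) + σ * ((x * x) * (x * x))   ≈⟨ +-congˡ norm-of-image-s ⟨
        (x * x) * (x * x) + σ * x                     ∎)

      weights-S₀ : α S₀ ≈ β S₀
      weights-S₀ = unit-cancelʳ x-unit (begin
        α S₀ * x                      ≈⟨ S₀-square-S₁ ⟨
        (v S₀ S₀ * v S₀ S₀) * β S₀    ≈⟨ *-congʳ (*-cong S₀-coordinate S₀-coordinate) ⟩
        ((x * x) * (x * x)) * β S₀    ≈⟨ *-congʳ x≈x⁴ ⟨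
        x * β S₀                      ≈⟨ *-comm x (β S₀) ⟩
        β S₀ * x                      ∎)

      1≈0 : 1# ≈ 0#
      1≈0 = +-cancelʳ 1# 1# 0# (begin
        1# + 1#          ≈⟨ deg-S₀ ⟨
        fromℕ (deg S₀)   ≈⟨ deg-ratio zero weights-S₀ ⟩
        1#               ≈⟨ +-identityˡ 1# ⟨
        0# + 1#          ∎)

    -- Vanishing at `S₀` and failure of surjectivity

    basis-image-on-S₀ : ∀ i → v i S₀ ≈ 0#
    basis-image-on-S₀ (leaf zero zero)    = L₀-on-S₀
    basis-image-on-S₀ (leaf (suc k) l)    = leaf-on-spine k l zero
    basis-image-on-S₀ (spine zero)        =
      zero-unless-unit λ u → ⊥-elim (1≉0 (S₀-supports-S₀.1≈0 u))
    basis-image-on-S₀ (spine (suc k))     = spine-on-S₀ k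

    image-zero : ∀ {k} → (∀ i → v i k ≈ 0#) → ∀ x → f x k ≈ 0#
    image-zero {k} h x = ≈-trans (image-expansion Cₐ hom x k)
      (∑-zero (All.universal (λ i → *-zeroʳ (h i)) vertices))

    not-surjective : ¬ (∃ λ x → ∀ k → f x k ≈ e Cₐ S₀ k)
    not-surjective (x , fx≈e) = 1≉0
      (≈-trans (≈-sym (≈-trans (fx≈e S₀) (e-same Cₐ S₀))) (image-zero basis-image-on-S₀ x))

    -- Vanishing of all images over a formally real field

    module _ (formallyReal : FormallyReal) where

      -- The leaf squares to its spine vertex. Read at `spine j`, with no spine coordinates left,
      -- this says that a sum of squares over the leaves of `spine j` is zero.
      leaf-on-leaf≈0 : ∀ k l j → (∀ j′ → v (leaf k l) (spine j′) ≈ 0#) → v (spine k) (spine j) ≈ 0# →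
                       ∀ l′ → v (leaf k l) (leaf j l′) ≈ 0#
      leaf-on-leaf≈0 k l j spine≈0 norm≈0 l′ = begin
        w (leaf j l′)       ≈⟨ *-identityʳ _ ⟨
        w (leaf j l′) * 1#  ≈⟨ *-congˡ (adjacency-edge Cₐ {leaf j l′} {spine j} up) ⟨
        g (leaf j l′)       ≈⟨ All.lookup (formallyReal (map g vertices) ∑g²≈0) (∈-map⁺ g (complete (leaf j l′))) ⟩
        0#                  ∎
        where
        w g : V → Carrier
        w = v (leaf k l)
        -- The 0/1 factor cuts `w` down to the neighbours of `spine j`, so that a sum of squares
        -- over all vertices can be used.
        g q = w q * fromℕ (adjacency q (spine j))

        ∑-map : ∀ is → ∑ (map g is) (λ y → y * y) ≈ ∑ is (λ q → g q * g q)
        ∑-map []            = ≈-refl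
        ∑-map (i List.∷ is) = +-congˡ (∑-map is)

        term : ∀ q → g q * g q ≈ (w q * w q) * D q (spine j)
        term (spine j′) = ≈-trans (*-zeroˡ (*-zeroˡ (spine≈0 j′))) (≈-sym (*-zeroˡ (*-zeroˡ (spine≈0 j′))))
        term q@(leaf j′ i) with FiniteConnectedGraph._~?_ Cₐ q (spine j)
        ... | no q≁j  = ≈-trans (*-zeroˡ (zeroʳ _)) (≈-sym (*-zeroʳ (D.nonedge q≁j)))
        ... | yes q~j = begin
          (w q * fromℕ 1) * (w q * fromℕ 1)  ≈⟨ *-cong (*-congˡ (+-identityʳ 1#)) (≈-trans (*-congˡ (+-identityʳ 1#)) (*-identityʳ _)) ⟩
          (w q * 1#) * w q                   ≈⟨ *-congʳ (*-identityʳ _) ⟩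
          w q * w q                          ≈⟨ *-identityʳ _ ⟨
          (w q * w q) * 1#                   ≈⟨ *-congˡ (≈-trans (D.edge q~j) β-leaf) ⟨
          (w q * w q) * D q (spine j)        ∎

        ∑g²≈0 : ∑ (map g vertices) (λ y → y * y) ≈ 0#
        ∑g²≈0 = ≈-trans (∑-map vertices) (≈-trans (∑-cong vertices term)
          (≈-trans (leaf-square k l (spine j)) norm≈0))

      -- For `L₀`, suppose the coordinate is a unit. Orthogonality then clears `spine j` from v(S₁),
      -- formal reality clears the leaves of `spine j` from the images of the leaves at `S₁`, and
      -- `L₀-on-spine≈0` applies.
      leaf-on-spine≈0 : ∀ k l j → v (leaf k l) (spine j) ≈ 0#
      leaf-on-spine≈0 (suc k) l    j = leaf-on-spine k l j
      leaf-on-spine≈0 zero    zero j = zero-unless-unit λ u →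
        let S₁≈0 = vanishes-beside {L₀} {S₁} (λ ()) u in
        L₀-on-spine≈0 j (some-leaf j) S₁≈0
          (λ l → leaf-on-leaf≈0 (suc zero) l j (leaf-on-spine zero l) S₁≈0 (some-leaf j))

      spine-on-any-leaf≈0 : ∀ k j l → v (spine k) (leaf j l) ≈ 0#
      spine-on-any-leaf≈0 (suc k) j l = spine-on-leaf≈0 k j l
      spine-on-any-leaf≈0 zero    j l =
        ≈-trans (spine-on-leaf zero zero j) (*-zeroˡ (*-zeroˡ (leaf-on-spine≈0 zero zero j)))

      -- The square of v(spine k) is read at the spine vertex `j⁻` just before the target. The
      -- induction covers all indices up to `n` because it is used both at `j⁻` and at the
      -- predecessor of `j⁻`; only the target's own square remains.
      spine-on-spine-below : ∀ n j → toℕ j ≤ n → ∀ k → v (spine k) (spine j) ≈ 0#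
      spine-on-spine-below n       zero    _         k = basis-image-on-S₀ (spine k)
      spine-on-spine-below (suc n) (suc j) (s≤s j≤n) k =
        square≈0 (unit-zeroʳ (D.unit (spine (suc j))) (begin
          (v (spine k) (spine (suc j)) * v (spine k) (spine (suc j))) * β (spine (suc j))
            ≈⟨ D.inflow-at {p = spine (suc j)} {k = spine j⁻} (path (inj₂ (≡.cong suc toℕ-j⁻))) others ⟨
          square (spine k) (spine j⁻)
            ≈⟨ v-square (spine k) (spine j⁻) ⟩
          ∑ vertices (λ q → C (spine k) q * v q (spine j⁻))
            ≈⟨ C.outflow-zero {i = spine k} (λ { (spine i) _ → IH j⁻ j⁻≤n i ; (leaf i l) _ → leaf-on-spine≈0 i l j⁻ }) ⟩
          0# ∎))
        where
        j⁻ : Fin (suc (suc (suc m)))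
        j⁻ = inject₁ j
        toℕ-j⁻ : toℕ j⁻ ≡ toℕ j
        toℕ-j⁻ = Fin.toℕ-inject₁ j
        j⁻≤n : toℕ j⁻ ≤ n
        j⁻≤n = ℕ.≤-trans (ℕ.≤-reflexive toℕ-j⁻) j≤n
        IH : ∀ i → toℕ i ≤ n → ∀ k → v (spine k) (spine i) ≈ 0#
        IH = spine-on-spine-below n
        others : ∀ q → q ~ spine j⁻ → spine (suc j) ≢ q → v (spine k) q * v (spine k) q ≈ 0#
        others (leaf i l) _ _ = *-zeroˡ (spine-on-any-leaf≈0 k i l)
        others (spine i) (path (inj₁ i+1≡j)) _ =
          *-zeroˡ (IH i (ℕ.≤-trans (ℕ.n≤1+n _) (ℕ.≤-trans (ℕ.≤-reflexive i+1≡j) j⁻≤n)) k)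
        others (spine i) (path (inj₂ j+1≡i)) j+1≢i = ⊥-elim (j+1≢i (≡.cong spine
          (Fin.toℕ-injective (≡.trans (≡.cong suc (≡.sym toℕ-j⁻)) j+1≡i))))

      spine-on-spine≈0 : ∀ k j → v (spine k) (spine j) ≈ 0#
      spine-on-spine≈0 k j = spine-on-spine-below (toℕ j) j ℕ.≤-refl k

      image≈0 : ∀ x k → f x k ≈ 0#
      image≈0 x k = image-zero (λ i → basis i k) x
        where
        basis : ∀ i k → v i k ≈ 0#
        basis (spine i)  (spine k)  = spine-on-spine≈0 i k
        basis (spine i)  (leaf k l) = spine-on-any-leaf≈0 i k l
        basis (leaf i l) (spine k)  = leaf-on-spine≈0 i l k
        basis (leaf i l) (leaf k j) =
          leaf-on-leaf≈0 i l k (leaf-on-spine≈0 i l) (spine-on-spine≈0 i k) j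

-- The null map as a homomorphism

module _ {r ℓr a ℓa b ℓb} {R : CommutativeRing r ℓr}
         (A : NonAssociativeAlgebra R a ℓa) (B : NonAssociativeAlgebra R b ℓb) where

  private
    module A = NonAssociativeAlgebra A
    module B = NonAssociativeAlgebra B
  open CommutativeRing R using (0#)
  open GroupProperties B.+ᴹ-group using (ε⁻¹≈ε)

  nullMap-isAlgebraHomomorphism : ∀ {f} → IsNullMap A B f → IsAlgebraHomomorphism A B f
  nullMap-isAlgebraHomomorphism {f} f≈0 = record
    { isLeftModuleHomomorphism = record
      { +ᴹ-isGroupHomomorphism = record
        { isMonoidHomomorphism = record
          { isMagmaHomomorphism = record
            { isRelHomomorphism = record { cong = λ {x} {y} _ → f≈ x (f≈0 y) }
            ; homo = λ x y → f≈ (x A.+ᴹ y)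
                (B.≈ᴹ-trans (B.+ᴹ-cong (f≈0 x) (f≈0 y)) (B.+ᴹ-identityˡ B.0ᴹ))
            }
          ; ε-homo = f≈0 A.0ᴹ
          }
        ; ⁻¹-homo = λ x → f≈ (A.-ᴹ x) (B.≈ᴹ-trans (B.-ᴹ‿cong (f≈0 x)) ε⁻¹≈ε)
        }
      ; *ₗ-homo = λ k x → f≈ (k A.*ₗ x)
          (B.≈ᴹ-trans (B.*ₗ-cong (CommutativeRing.refl R) (f≈0 x)) (B.*ₗ-zeroʳ k))
      }
    ; ∙-homo = λ x y → f≈ (x A.∙ y) (B.≈ᴹ-trans (B.∙-cong (f≈0 x) (f≈0 y)) 0∙0≈0)
    }
    where
    f≈ : ∀ x {y} → y B.≈ᴹ B.0ᴹ → f x B.≈ᴹ y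
    f≈ x y≈0 = B.≈ᴹ-trans (f≈0 x) (B.≈ᴹ-sym y≈0)

    0∙0≈0 : B.0ᴹ B.∙ B.0ᴹ B.≈ᴹ B.0ᴹ
    0∙0≈0 = B.≈ᴹ-trans (B.∙-cong (B.≈ᴹ-sym (B.*ₗ-zeroˡ B.0ᴹ)) B.≈ᴹ-refl)
      (B.≈ᴹ-trans (B.∙-*ₗˡ 0# B.0ᴹ B.0ᴹ) (B.*ₗ-zeroˡ _))

-- Weights of the graph algebra and of the random walk algebra

module GraphWeights {c ℓ₁ ℓ₂} (K : HeytingField c ℓ₁ ℓ₂) (G : FiniteConnectedGraph) where

  open Evolution K
  open HeytingFieldLemmas K
  open HeytingField K renaming (refl to ≈-refl; sym to ≈-sym; trans to ≈-trans) hiding (zero)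
  open FiniteConnectedGraph G using (Vertex; adjacency; deg)

  graph-weighted : Weighted G (λ i k → fromℕ (adjacency i k)) (λ _ → 1#)
  graph-weighted = record
    { edge    = adjacency-edge G
    ; nonedge = adjacency-nonedge G
    ; unit    = λ _ → 1# , *-identityˡ 1#
    }

  module _ (deg#0 : DegreesNonzero G) where

    inverse-degree : Vertex → Carrier
    inverse-degree i = recip (deg#0 i)

    walk-weighted : Weighted G (λ i k → fromℕ (adjacency i k) * inverse-degree i) inverse-degree
    walk-weighted = record
      { edge    = λ i~k → ≈-trans (*-congʳ (adjacency-edge G i~k)) (*-identityˡ _)
      ; nonedge = λ i≁k → *-zeroˡ (adjacency-nonedge G i≁k)
      ; unit    = λ i → fromℕ (deg i) , ≈-trans (*-comm _ _) (recip-inverseʳ (deg#0 i))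
      }

    inverse-degree≈1 : ∀ {i} → fromℕ (deg i) ≈ 1# → inverse-degree i ≈ 1#
    inverse-degree≈1 {i} deg≈1 = ≈-trans (≈-sym (*-identityˡ _))
      (≈-trans (*-congʳ (≈-sym deg≈1)) (recip-inverseʳ (deg#0 i)))

    deg≈1 : ∀ {i} → inverse-degree i ≈ 1# → fromℕ (deg i) ≈ 1#
    deg≈1 {i} inv≈1 = ≈-trans (≈-sym (*-identityʳ _))
      (≈-trans (*-congˡ (≈-sym inv≈1)) (recip-inverseʳ (deg#0 i)))

proposition3p2 : ∀ {c ℓ₁ ℓ₂} (K : HeytingField c ℓ₁ ℓ₂) → let open Evolution K in
    (m : ℕ) → 3 ≤ suc m →
    (a : Vector ℕ m) → (∀ (k : Fin m) → 1 < a k) →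
    let Cₐ = caterpillar (1 ∷ a) in
    (deg#0 : DegreesNonzero Cₐ) →
    ¬ (𝒜 Cₐ ≅ 𝒜RW Cₐ deg#0)
    × (FormallyReal →
    (∀ f → IsAlgebraHomomorphism (𝒜 Cₐ) (𝒜RW Cₐ deg#0) f ⇔ IsNullMap (𝒜 Cₐ) (𝒜RW Cₐ deg#0) f)
    × (∀ f → IsAlgebraHomomorphism (𝒜RW Cₐ deg#0) (𝒜 Cₐ) f ⇔ IsNullMap (𝒜RW Cₐ deg#0) (𝒜 Cₐ) f))
-- Matching on the bound exposes the three spine vertices `S₀`, `S₁`, `S₂`.
proposition3p2 K (suc (suc m)) (s≤s (s≤s (s≤s _))) a 1<a deg#0 =
  (λ { (f , iso) → To.not-surjective (isAlgebraHomomorphism iso) (surjection f iso) }) ,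
  λ formallyReal →
    (λ f → mk⇔ (λ hom → To.image≈0 hom formallyReal)
               (nullMap-isAlgebraHomomorphism (𝒜 Cₐ) (𝒜RW Cₐ deg#0))) ,
    (λ f → mk⇔ (λ hom → From.image≈0 hom formallyReal)
               (nullMap-isAlgebraHomomorphism (𝒜RW Cₐ deg#0) (𝒜 Cₐ)))
  where
  open Evolution K
  open CaterpillarHomomorphism K m a 1<a
  open GraphWeights K Cₐ
  open HeytingField K using (Carrier; _≈_) renaming (refl to ≈-refl; sym to ≈-sym)
  open IsAlgebraIsomorphism using (isAlgebraHomomorphism; bijective)

  -- The two directions differ only by exchanging the weight functions.
  module To = Images graph-weighted (walk-weighted deg#0)
    ≈-refl (λ {k} {l} → inverse-degree≈1 deg#0 (deg-leaf {k} {l}))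
    (λ k eq → deg≈1 deg#0 {spine k} (≈-sym eq))
  module From = Images (walk-weighted deg#0) graph-weighted
    (λ {k} {l} → inverse-degree≈1 deg#0 (deg-leaf {k} {l})) ≈-refl
    (λ k eq → deg≈1 deg#0 {spine k} eq)

  surjection : ∀ f → IsAlgebraIsomorphism (𝒜 Cₐ) (𝒜RW Cₐ deg#0) f →
               ∃ λ x → ∀ k → f x k ≈ e Cₐ S₀ k
  surjection f iso with proj₂ (bijective iso) (e Cₐ S₀)
  -- Surjectivity speaks of every argument equal to `x`; it is taken at `x` itself.
  ... | x , fx≈e = x , fx≈e λ _ → ≈-refl
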